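{- Assume each bonus function $f_i$ is nonnegative, nondecreasing, and discrete concave on $\{0,1,\dots,b_i\}$ with $f_i(0)=0$. Fix a feasible base allocation $\boldsymbol s$. For any repair increment $\boldsymbol d$ from $\boldsymbol s$ with $D=\|\boldsymbol d\|_1\ge1$, there exists a repair order $\eta=(\eta_1,\dots,\eta_D)$ for $\boldsymbol d$ such that, for every $h=0,1,\dots,D$, the prefix increment $\boldsymbol d^{(h)}$ induced by the first $h$ allocations in $\eta$ satisfies $$V(\boldsymbol s+\boldsymbol d^{(h)})-V(\boldsymbol s)\ \ge\ \left(\frac hD\right)^2\bigl(V(\boldsymbol s+\boldsymbol d)-V(\boldsymbol s)\bigr).$$ Moreover, such an order can be constructed by reverse deletion: initialize $\boldsymbol d^{\mathrm{rem}}=\boldsymbol d$ and an empty deletion list; while $\|\boldsymbol d^{\mathrm{rem}}\|_1>0$, choose a product $i$ with $d^{\mathrm{rem}}_i>0$ that minimizes $V(\boldsymbol s+\boldsymbol d^{\mathrm{rem}})-V(\boldsymbol s+\boldsymbol d^{\mathrm{rem}}-\boldsymbol e_i)$ (where $\boldsymbol e_i$ is the $i$-th unit vector), delete one unit of product $i$ from $\boldsymbol d^{\mathrm{rem}}$, and append $i$ to the deletion list. Reversing the deletion list gives the repair order $\eta$.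
   Context: There are products $\mathcal I=\{1,\dots,m\}$ with capacities $b_i\in\mathbb Z_+$, base rewards $r_i\ge0$ and bonus functions $f_i:\mathbb Z_+\to\mathbb R_+$. Let $R_i(n)=n r_i+\sum_{k=1}^n f_i(k)$ for $n=1,\dots,b_i$, $R_i(0)=0$, and $V(\boldsymbol x)=\sum_{i\in\mathcal I}R_i(x_i)$. Discrete concavity of $f_i$ on $\{0,\dots,b_i\}$: $f_i(k+1)-f_i(k)\le f_i(k)-f_i(k-1)$ for $k=1,\dots,b_i-1$. A feasible base allocation is $\boldsymbol s\in\mathbb Z_+^m$ with $s_i\le b_i$ for all $i$. A (feasible) repair increment from $\boldsymbol s$ is $\boldsymbol d\in\mathbb Z_+^m$ with $0\le d_i\le b_i-s_i$ for every $i$. A repair order for $\boldsymbol d$, with $D=\|\boldsymbol d\|_1=\sum_i d_i$, is a sequence $\eta=(\eta_1,\dots,\eta_D)$ of products containing exactly $d_i$ copies of each product $i$. For $h=0,\dots,D$, the prefix increment $\boldsymbol d^{(h)}$ is given by $d^{(h)}_i=|\{\tau\le h:\eta_\tau=i\}|$. -}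

module Defs where

open import Algebra.Bundles using (CommutativeRing)
open import Algebra.Core using (Op₁; Op₂)
open import Algebra.Structures using (IsCommutativeRing)
open import Data.Fin.Base using (Fin; toℕ)
open import Data.Fin.Properties using (_≟_)
open import Data.List.Base using (List; []; _∷ʳ_; filter; length; take)
open import Data.Nat.Base as ℕ using (ℕ; suc; pred; +-0-rawMonoid)
open import Data.Product.Base using (_×_; _,_; ∃-syntax)
open import Data.Vec.Functional using (Vector; updateAt; zipWith)
open import Level using (Level; _⊔_) renaming (suc to lsuc)
open import Relation.Binary.Construct.Closure.ReflexiveTransitive using (Star)
open import Relation.Binary.Core using (Rel)
open import Relation.Binary.PropositionalEquality.Core using (_≡_)
open import Relation.Binary.Structures using (IsTotalOrder)
open import Relation.Nullary.Negation.Core using (¬_)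
import Algebra.Definitions.RawMonoid as RawMonoidDefinitions
import Algebra.Properties.Semiring.Exp as Exponentiation

-- Totally ordered fields.  These play the role of ℝ, which the standard
-- library lacks: classically, ℝ is an instance.

record OrderedField (c ℓ₁ ℓ₂ : Level) : Set (lsuc (c ⊔ ℓ₁ ⊔ ℓ₂)) where
  infix  9 _⁻¹
  infix  8 -_
  infixl 7 _*_ _/_
  infixl 6 _+_
  infix  4 _≈_ _≤_
  field
    Carrier           : Set c
    _≈_               : Rel Carrier ℓ₁
    _≤_               : Rel Carrier ℓ₂
    _+_               : Op₂ Carrier
    _*_               : Op₂ Carrier
    -_                : Op₁ Carrier
    _⁻¹               : Op₁ Carrier
    0#                : Carrier
    1#                : Carrier
    isCommutativeRing : IsCommutativeRing _≈_ _+_ _*_ -_ 0# 1#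
    0≉1               : ¬ (0# ≈ 1#)
    -- Nothing is assumed about the value of 0# ⁻¹.
    ⁻¹-inverseʳ       : ∀ x → ¬ (x ≈ 0#) → x * x ⁻¹ ≈ 1#
    isTotalOrder      : IsTotalOrder _≈_ _≤_
    +-monoˡ-≤         : ∀ {x y} z → x ≤ y → x + z ≤ y + z
    *-nonneg          : ∀ {x y} → 0# ≤ x → 0# ≤ y → 0# ≤ x * y

  commutativeRing : CommutativeRing c ℓ₁
  commutativeRing = record { isCommutativeRing = isCommutativeRing }

  open CommutativeRing commutativeRing public
    using (_-_; semiring; +-rawMonoid)
  open RawMonoidDefinitions +-rawMonoid public
    using (sum) renaming (_×_ to _·_)
  open Exponentiation semiring public using (_^_)

  _/_ : Op₂ Carrier
  x / y = x * y ⁻¹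

  fromℕ : ℕ → Carrier
  fromℕ n = n · 1#

∥_∥₁ : ∀ {m} → Vector ℕ m → ℕ
∥ d ∥₁ = RawMonoidDefinitions.sum +-0-rawMonoid d

infixl 6 _⊕_

_⊕_ : ∀ {m} → Vector ℕ m → Vector ℕ m → Vector ℕ m
_⊕_ = zipWith ℕ._+_

-- d − eᵢ.  The predecessor is truncated, so this is only meaningful when
-- 0 < d i.
_⊖e_ : ∀ {m} → Vector ℕ m → Fin m → Vector ℕ m
d ⊖e i = updateAt d i pred

occurrences : ∀ {m} → Fin m → List (Fin m) → ℕ
occurrences i xs = length (filter (i ≟_) xs)

prefixIncrement : ∀ {m} → List (Fin m) → ℕ → Vector ℕ m
prefixIncrement η h i = occurrences i (take h η)

record IsRepairOrder {m} (d : Vector ℕ m) (η : List (Fin m)) : Set where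
  field
    length≡      : length η ≡ ∥ d ∥₁
    occurrences≡ : ∀ i → occurrences i η ≡ d i

module _ {c ℓ₁ ℓ₂ : Level} (F : OrderedField c ℓ₁ ℓ₂) where
  open OrderedField F

  record Instance : Set (c ⊔ ℓ₂) where
    field
      m        : ℕ
      b        : Vector ℕ m
      r        : Vector Carrier m
      f        : Fin m → ℕ → Carrier
      r-nonneg : ∀ i → 0# ≤ r i
      f-nonneg : ∀ i k → 0# ≤ f i k

module _ {c ℓ₁ ℓ₂ : Level} {F : OrderedField c ℓ₁ ℓ₂} (P : Instance F) where
  open OrderedField F
  open Instance P

  -- The summation index is shifted: Σ_{k=1}^{n} fᵢ(k).
  R : Fin m → ℕ → Carrier
  R i n = n · r i + sum {n} (λ k → f i (suc (toℕ k)))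

  V : Vector ℕ m → Carrier
  V x = sum (λ i → R i (x i))

  NondecreasingBonus : Fin m → Set ℓ₂
  NondecreasingBonus i = ∀ {j k} → j ℕ.≤ k → k ℕ.≤ b i → f i j ≤ f i k

  -- The middle point of the second difference is suc k, which ranges
  -- over 1, …, bᵢ − 1.
  DiscreteConcaveBonus : Fin m → Set ℓ₂
  DiscreteConcaveBonus i = ∀ k → suc k ℕ.< b i →
    f i (suc (suc k)) - f i (suc k) ≤ f i (suc k) - f i k

  -- Nonnegativity of fᵢ is part of Instance.
  record AdmissibleBonuses : Set (ℓ₁ ⊔ ℓ₂) where
    field
      f-zero          : ∀ i → f i 0 ≈ 0#
      f-nondecreasing : ∀ i → NondecreasingBonus i
      f-concave       : ∀ i → DiscreteConcaveBonus i

  IsFeasible : Vector ℕ m → Set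
  IsFeasible s = ∀ i → s i ℕ.≤ b i

  IsRepairIncrement : Vector ℕ m → Vector ℕ m → Set
  IsRepairIncrement s d = ∀ i → d i ℕ.≤ b i ℕ.∸ s i

  QuadraticBound : (s d : Vector ℕ m) → List (Fin m) → Set ℓ₂
  QuadraticBound s d η = ∀ h → h ℕ.≤ ∥ d ∥₁ →
    (fromℕ h / fromℕ ∥ d ∥₁) ^ 2 * (V (s ⊕ d) - V s)
      ≤ V (s ⊕ prefixIncrement η h) - V s

  deletionLoss : (s rem : Vector ℕ m) → Fin m → Carrier
  deletionLoss s rem i = V (s ⊕ rem) - V (s ⊕ (rem ⊖e i))

  -- The remaining increment together with the deletion list so far.
  State : Set
  State = Vector ℕ m × List (Fin m)

  -- The relation is not functional: ties may be broken arbitrarily.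
  data DeletionStep (s : Vector ℕ m) : State → State → Set ℓ₂ where
    delete : ∀ {rem δ} i → 0 ℕ.< rem i →
      (∀ j → 0 ℕ.< rem j → deletionLoss s rem i ≤ deletionLoss s rem j) →
      DeletionStep s (rem , δ) (rem ⊖e i , δ ∷ʳ i)

  -- Some complete run started from d ends with deletion list δ.
  ReverseDeletion : (s d : Vector ℕ m) → List (Fin m) → Set ℓ₂
  ReverseDeletion s d δ =
    ∃[ rem ] Star (DeletionStep s) (d , []) (rem , δ) × ∥ rem ∥₁ ≡ 0

{-# OPTIONS --safe #-}

-- Let W(e) = V(s + e) − V(s), and let L be the least deletion loss at a
-- remaining increment e with ∥e∥₁ = n + 1.  Along each product the marginal
-- rewards a(k) = r + f(s + k) are concave in k with a(0) ≥ 0, so a(k)/k is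
-- nonincreasing and the first k ≥ 1 of them sum to at least (k + 1)/2 · a(k).
-- Summing over the products gives 2 W(e) ≥ (n + 2) L, that is
-- 2 W(e − eᵢ) ≥ n L for the deleted product i, and therefore
-- (n + 1)² W(e − eᵢ) ≥ n² W(e).  These ratios telescope along the deletions.
module Submission where

open import Defs
open import Algebra.Bundles using (CommutativeMonoid; CommutativeRing)
open import Data.Empty using (⊥-elim)
open import Data.Fin.Base using (Fin; zero; suc; toℕ; punchIn)
open import Data.Fin.Properties using (_≟_; punchInᵢ≢i; toℕ-fromℕ; toℕ-inject₁)
open import Data.List.Base using (List; []; _∷_; _∷ʳ_; _++_; reverse; length; take;
  filter; allFin)
open import Data.List.Membership.Propositional.Properties using (∈-allFin; ∈-filter⁺)
open import Data.List.Properties using (++-assoc; ++-identityʳ; filter-++; length-++; length-take;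
  reverse-++; reverse-involutive; take-all)
open import Data.List.Relation.Unary.All as All using (All)
open import Data.List.Relation.Unary.All.Properties using (all-filter)
open import Data.Nat.Base as ℕ using (ℕ; zero; suc; _≤_; _<_; z≤n; s≤s; _∸_)
open import Data.Product.Base using (_×_; _,_; proj₁; proj₂; ∃-syntax)
open import Data.Sum.Base using (inj₁; inj₂)
open import Data.Vec.Functional using (Vector; removeAt; init; last)
open import Data.Vec.Functional.Properties using (updateAt-updates; updateAt-minimal)
open import Function.Base using (_∘_)
open import Relation.Binary.Bundles using (TotalOrder)
open import Relation.Binary.Construct.Closure.ReflexiveTransitive using (Star; ε; _◅_)
open import Relation.Binary.PropositionalEquality as ≡ using (_≡_; _≢_; _≗_; refl)
open import Relation.Nullary using (¬_; yes; no)
import Algebra.Properties.CommutativeMonoid.Mult as MonoidMult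
import Algebra.Properties.CommutativeMonoid.Sum as MonoidSum
import Algebra.Properties.Ring as RingProperties
import Algebra.Properties.Semiring.Mult as SemiringMult
import Data.List.Extrema as Extrema
import Data.Nat.Properties as ℕ
import Data.Nat.Tactic.RingSolver as ℕ-Solver
import Relation.Binary.Reasoning.PartialOrder as PartialOrderReasoning

-- Sums of families that differ at one index.

module _ {c ℓ} (M : CommutativeMonoid c ℓ) where
  open CommutativeMonoid M
  open MonoidSum M using (sum; sum-remove; sum-cong-≋)
  open import Relation.Binary.Reasoning.Setoid setoid

  -- Stated for any commutative monoid because it serves twice: over `ℕ` for the norm of an
  -- increment, and over the field for the value of an allocation.
  sum-differ-at : ∀ {n} (i : Fin n) {x y : Vector Carrier n} {a} →
    (∀ j → j ≢ i → x j ≈ y j) → x i ≈ y i ∙ a → sum x ≈ sum y ∙ a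
  sum-differ-at {suc n} i {x} {y} {a} same diff = begin
    sum x                              ≈⟨ sum-remove x ⟩
    x i ∙ sum (removeAt x i)
      ≈⟨ ∙-cong diff (sum-cong-≋ λ j → same (punchIn i j) (punchInᵢ≢i i j)) ⟩
    (y i ∙ a) ∙ sum (removeAt y i)     ≈⟨ assoc _ _ _ ⟩
    y i ∙ (a ∙ sum (removeAt y i))     ≈⟨ ∙-congˡ (comm _ _) ⟩
    y i ∙ (sum (removeAt y i) ∙ a)     ≈⟨ assoc _ _ _ ⟨
    (y i ∙ sum (removeAt y i)) ∙ a     ≈⟨ ∙-congʳ (sum-remove y) ⟨
    sum y ∙ a                          ∎

-- Unit deletions and the norm of an increment.

module _ {m : ℕ} where

  ⊖e-at : ∀ (e : Vector ℕ m) i → 0 < e i → e i ≡ suc ((e ⊖e i) i)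
  ⊖e-at e i 0<eᵢ = ≡.trans (≡.sym (ℕ.suc-pred (e i) ⦃ ℕ.>-nonZero 0<eᵢ ⦄))
                           (≡.cong suc (≡.sym (updateAt-updates i e)))

  ⊖e-off : ∀ (e : Vector ℕ m) i j → j ≢ i → e j ≡ (e ⊖e i) j
  ⊖e-off e i j j≢i = ≡.sym (updateAt-minimal j i e j≢i)

  ⊖e≤ : ∀ (e : Vector ℕ m) i j → (e ⊖e i) j ≤ e j
  ⊖e≤ e i j with j ≟ i
  ... | yes refl = ℕ.≤-trans (ℕ.≤-reflexive (updateAt-updates i e)) ℕ.pred[n]≤n
  ... | no j≢i   = ℕ.≤-reflexive (updateAt-minimal j i e j≢i)

  ∥∥-cong : {x y : Vector ℕ m} → x ≗ y → ∥ x ∥₁ ≡ ∥ y ∥₁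
  ∥∥-cong = MonoidSum.sum-cong-≗ ℕ.+-0-commutativeMonoid

  ∥∥-add-at : ∀ i {x y : Vector ℕ m} →
    (∀ j → j ≢ i → x j ≡ y j) → x i ≡ suc (y i) → ∥ x ∥₁ ≡ suc ∥ y ∥₁
  ∥∥-add-at i {x} {y} same diff =
    ≡.trans (sum-differ-at ℕ.+-0-commutativeMonoid i same (≡.trans diff (ℕ.+-comm 1 _)))
            (ℕ.+-comm ∥ y ∥₁ 1)

  ∥⊖e∥ : ∀ (e : Vector ℕ m) i → 0 < e i → ∥ e ∥₁ ≡ suc ∥ e ⊖e i ∥₁
  ∥⊖e∥ e i 0<eᵢ = ∥∥-add-at i (⊖e-off e i) (⊖e-at e i 0<eᵢ)

∥∥≡0⇒≡0 : ∀ {m} (x : Vector ℕ m) → ∥ x ∥₁ ≡ 0 → ∀ i → x i ≡ 0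
∥∥≡0⇒≡0 x eq zero    = ℕ.m+n≡0⇒m≡0 (x zero) eq
∥∥≡0⇒≡0 x eq (suc i) = ∥∥≡0⇒≡0 (x ∘ suc) (ℕ.m+n≡0⇒n≡0 (x zero) eq) i

∥0∥≡0 : ∀ m → ∥ (λ (_ : Fin m) → 0) ∥₁ ≡ 0
∥0∥≡0 zero    = refl
∥0∥≡0 (suc m) = ∥0∥≡0 m

∥∥>0⇒∃>0 : ∀ {m} (x : Vector ℕ m) → 0 < ∥ x ∥₁ → ∃[ i ] 0 < x i
∥∥>0⇒∃>0 {suc m} x 0<∥x∥ with x zero in eq
... | suc k = zero , ≡.subst (0 <_) (≡.sym eq) (s≤s z≤n)
... | zero  with ∥∥>0⇒∃>0 (x ∘ suc) 0<∥x∥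
...   | i , 0<xᵢ = suc i , 0<xᵢ

-- Prefixes of lists and occurrence counts.

take-++ˡ : ∀ {a} {A : Set a} n (xs ys : List A) → n ≤ length xs → take n (xs ++ ys) ≡ take n xs
take-++ˡ zero    xs       ys n≤         = refl
take-++ˡ (suc n) (x ∷ xs) ys (s≤s n≤) = ≡.cong (x ∷_) (take-++ˡ n xs ys n≤)

module _ {m : ℕ} where

  occurrences-++ : ∀ (i : Fin m) xs ys →
    occurrences i (xs ++ ys) ≡ occurrences i xs ℕ.+ occurrences i ys
  occurrences-++ i xs ys = ≡.trans (≡.cong length (filter-++ (i ≟_) xs ys))
                                   (length-++ (filter (i ≟_) xs))

  occurrences-∷ʳ-same : ∀ (i : Fin m) xs → occurrences i (xs ∷ʳ i) ≡ suc (occurrences i xs)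
  occurrences-∷ʳ-same i xs = ≡.trans (occurrences-++ i xs (i ∷ []))
    (≡.trans (≡.cong (occurrences i xs ℕ.+_) single) (ℕ.+-comm _ 1))
    where
    single : occurrences i (i ∷ []) ≡ 1
    single with i ≟ i
    ... | yes _  = refl
    ... | no i≢i = ⊥-elim (i≢i refl)

  occurrences-∷ʳ-other : ∀ {i j : Fin m} xs → j ≢ i → occurrences j (xs ∷ʳ i) ≡ occurrences j xs
  occurrences-∷ʳ-other {i} {j} xs j≢i = ≡.trans (occurrences-++ j xs (i ∷ []))
    (≡.trans (≡.cong (occurrences j xs ℕ.+_) none) (ℕ.+-identityʳ _))
    where
    none : occurrences j (i ∷ []) ≡ 0
    none with j ≟ i
    ... | yes j≡i = ⊥-elim (j≢i j≡i)
    ... | no _    = refl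

  ∥occurrences∥ : ∀ (xs : List (Fin m)) → ∥ (λ i → occurrences i xs) ∥₁ ≡ length xs
  ∥occurrences∥ []       = ∥0∥≡0 m
  ∥occurrences∥ (x ∷ xs) = ≡.trans (∥∥-add-at x other same) (≡.cong suc (∥occurrences∥ xs))
    where
    other : ∀ j → j ≢ x → occurrences j (x ∷ xs) ≡ occurrences j xs
    other j j≢x with j ≟ x
    ... | yes j≡x = ⊥-elim (j≢x j≡x)
    ... | no _    = refl
    same : occurrences x (x ∷ xs) ≡ suc (occurrences x xs)
    same with x ≟ x
    ... | yes _  = refl
    ... | no x≢x = ⊥-elim (x≢x refl)

  occurrences≡⇒IsRepairOrder : ∀ {d : Vector ℕ m} {η} →
    (∀ i → occurrences i η ≡ d i) → IsRepairOrder d η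
  occurrences≡⇒IsRepairOrder {η = η} occ≡ = record
    { length≡      = ≡.trans (≡.sym (∥occurrences∥ η)) (∥∥-cong occ≡)
    ; occurrences≡ = occ≡
    }

  ∥prefixIncrement∥ : ∀ (η : List (Fin m)) {h} → h ≤ length η → ∥ prefixIncrement η h ∥₁ ≡ h
  ∥prefixIncrement∥ η {h} h≤ = ≡.trans (∥occurrences∥ (take h η))
    (≡.trans (length-take h η) (ℕ.m≤n⇒m⊓n≡m h≤))

-- Order and natural multiples in an ordered field.

module OrderedFieldProperties {c ℓ₁ ℓ₂} (F : OrderedField c ℓ₁ ℓ₂) where
  open OrderedField F renaming (_≤_ to _⊑_)
  open CommutativeRing commutativeRing
    using (ring; +-commutativeMonoid; +-congˡ; +-congʳ; +-comm; +-assoc;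
           +-identityʳ; +-identityˡ; -‿inverseʳ; -‿inverseˡ; *-identityˡ; *-identityʳ;
           -‿cong; *-congˡ; *-congʳ; *-comm; *-assoc)
    renaming (refl to ≈-refl; sym to ≈-sym; trans to ≈-trans)
  open MonoidMult +-commutativeMonoid using (×-congʳ; ×-congˡ; ×-homo-+; ×-assocˡ; ×-distrib-+)
  open RingProperties ring using (-‿distribˡ-*; -‿involutive)

  totalOrder : TotalOrder c ℓ₁ ℓ₂
  totalOrder = record { isTotalOrder = isTotalOrder }

  open TotalOrder totalOrder using (poset; total; antisym; ≤-respˡ-≈; ≤-respʳ-≈)
    renaming (refl to ⊑-refl; reflexive to ⊑-reflexive)
  open PartialOrderReasoning poset

  x+y-y≈x : ∀ x y → x + y - y ≈ x
  x+y-y≈x x y = ≈-trans (+-assoc x y (- y)) (≈-trans (+-congˡ (-‿inverseʳ y)) (+-identityʳ x))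

  x≈y+z⇒x-y≈z : ∀ {x y z} → x ≈ y + z → x - y ≈ z
  x≈y+z⇒x-y≈z {x} {y} {z} eq = ≈-trans (+-congʳ (≈-trans eq (+-comm y z))) (x+y-y≈x z y)

  x-y+y≈x : ∀ x y → x - y + y ≈ x
  x-y+y≈x x y = ≈-trans (+-assoc x (- y) y) (≈-trans (+-congˡ (-‿inverseˡ y)) (+-identityʳ x))

  +-mono-⊑ : ∀ {x y u v} → x ⊑ y → u ⊑ v → x + u ⊑ y + v
  +-mono-⊑ {x} {y} {u} {v} x⊑y u⊑v = begin
    x + u  ≤⟨ +-monoˡ-≤ u x⊑y ⟩
    y + u  ≈⟨ +-comm y u ⟩
    u + y  ≤⟨ +-monoˡ-≤ y u⊑v ⟩
    v + y  ≈⟨ +-comm v y ⟩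
    y + v  ∎

  +-cancelʳ-⊑ : ∀ {x y} z → x + z ⊑ y + z → x ⊑ y
  +-cancelʳ-⊑ {x} {y} z p = begin
    x          ≈⟨ x+y-y≈x x z ⟨
    x + z - z  ≤⟨ +-monoˡ-≤ (- z) p ⟩
    y + z - z  ≈⟨ x+y-y≈x y z ⟩
    y          ∎

  nonneg-+ : ∀ {x y} → 0# ⊑ x → 0# ⊑ y → 0# ⊑ x + y
  nonneg-+ {x} {y} p q = begin
    0#       ≈⟨ +-identityʳ 0# ⟨
    0# + 0#  ≤⟨ +-mono-⊑ p q ⟩
    x + y    ∎

  ·-mono-⊑ : ∀ n {x y} → x ⊑ y → n · x ⊑ n · y
  ·-mono-⊑ zero    p = ⊑-refl
  ·-mono-⊑ (suc n) p = +-mono-⊑ p (·-mono-⊑ n p)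

  ·-nonneg : ∀ n {x} → 0# ⊑ x → 0# ⊑ n · x
  ·-nonneg zero    p = ⊑-refl
  ·-nonneg (suc n) p = nonneg-+ p (·-nonneg n p)

  x⊑y+x : ∀ {x y} → 0# ⊑ y → x ⊑ y + x
  x⊑y+x {x} {y} p = begin
    x       ≈⟨ +-identityˡ x ⟨
    0# + x  ≤⟨ +-monoˡ-≤ x p ⟩
    y + x   ∎

  -- By totality only `y ⊑ x` needs work: then `n · y ⊑ n · x`, and a common `n · x` can be
  -- cancelled. This lets the main estimates be written with natural multiples and no division.
  ·-cancelˡ-⊑ : ∀ n {x y} → suc n · x ⊑ suc n · y → x ⊑ y
  ·-cancelˡ-⊑ n {x} {y} p with total x y
  ... | inj₁ x⊑y = x⊑y
  ... | inj₂ y⊑x = +-cancelʳ-⊑ (n · x) (begin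
    x + n · x  ≤⟨ p ⟩
    y + n · y  ≤⟨ +-mono-⊑ ⊑-refl (·-mono-⊑ n y⊑x) ⟩
    y + n · x  ∎)

  ·-swap : ∀ m n x → m · n · x ≈ n · m · x
  ·-swap m n x = begin-equality
    m · n · x      ≈⟨ ×-assocˡ x m n ⟩
    (m ℕ.* n) · x  ≈⟨ ×-congˡ (ℕ.*-comm m n) ⟩
    (n ℕ.* m) · x  ≈⟨ ×-assocˡ x n m ⟨
    n · m · x      ∎

  -- Were 1 below 0, then -1 would be nonnegative, and so would its square, which is 1.
  0⊑1 : 0# ⊑ 1#
  0⊑1 with total 0# 1#
  ... | inj₁ 0⊑1 = 0⊑1
  ... | inj₂ 1⊑0 = ≤-respʳ-≈ [-1][-1]≈1 (*-nonneg 0⊑-1 0⊑-1)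
    where
    0⊑-1 : 0# ⊑ - 1#
    0⊑-1 = begin
      0#         ≈⟨ -‿inverseʳ 1# ⟨
      1# + - 1#  ≤⟨ +-monoˡ-≤ (- 1#) 1⊑0 ⟩
      0# + - 1#  ≈⟨ +-identityˡ (- 1#) ⟩
      - 1#       ∎
    [-1][-1]≈1 : - 1# * - 1# ≈ 1#
    [-1][-1]≈1 = begin-equality
      - 1# * - 1#      ≈⟨ -‿distribˡ-* 1# (- 1#) ⟨
      - (1# * - 1#)    ≈⟨ -‿cong (*-identityˡ (- 1#)) ⟩
      - (- 1#)         ≈⟨ -‿involutive 1# ⟩
      1#               ∎

  -- Characteristic zero: a vanishing `suc n` would squeeze 1 between 0 and 0.
  fromℕ-suc≉0 : ∀ n → ¬ (fromℕ (suc n) ≈ 0#)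
  fromℕ-suc≉0 n eq = 0≉1 (antisym 0⊑1 (begin
    1#               ≤⟨ x⊑y+x (·-nonneg n 0⊑1) ⟩
    fromℕ n + 1#     ≈⟨ +-comm (fromℕ n) 1# ⟩
    fromℕ (suc n)    ≈⟨ eq ⟩
    0#               ∎))

  fromℕ-* : ∀ n x → fromℕ n * x ≈ n · x
  fromℕ-* n x = ≈-trans (SemiringMult.×-assoc-* semiring n 1# x) (×-congʳ n (*-identityˡ x))

  ·-/-cancel : ∀ h n x → suc n · (fromℕ h / fromℕ (suc n) * x) ≈ h · x
  ·-/-cancel h n x = begin-equality
    suc n · (q * x)        ≈⟨ fromℕ-* (suc n) (q * x) ⟨
    D * (q * x)            ≈⟨ *-assoc D q x ⟨
    D * (H * D ⁻¹) * x     ≈⟨ *-congʳ (*-congˡ (*-comm H (D ⁻¹))) ⟩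
    D * (D ⁻¹ * H) * x     ≈⟨ *-congʳ (*-assoc D (D ⁻¹) H) ⟨
    D * D ⁻¹ * H * x       ≈⟨ *-congʳ (*-congʳ (⁻¹-inverseʳ D (fromℕ-suc≉0 n))) ⟩
    1# * H * x             ≈⟨ *-congʳ (*-identityˡ H) ⟩
    H * x                  ≈⟨ fromℕ-* h x ⟩
    h · x                  ∎
    where
    D = fromℕ (suc n)
    H = fromℕ h
    q = H / D

  -- Translates the division-free estimate into the quotient of the theorem: multiply by `D` twice,
  -- clearing one factor `h / D` each time, and cancel.
  square-ratio-bound : ∀ h D {x y} → 0 < D → (h ℕ.* h) · x ⊑ (D ℕ.* D) · y →
    (fromℕ h / fromℕ D) ^ 2 * x ⊑ y
  square-ratio-bound h (suc n) {x} {y} _ p = ·-cancelˡ-⊑ n (·-cancelˡ-⊑ n (begin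
    suc n · suc n · (q ^ 2 * x)        ≈⟨ ×-congʳ (suc n) (×-congʳ (suc n) q²x≈) ⟩
    suc n · suc n · (q * (q * x))      ≈⟨ ×-congʳ (suc n) (·-/-cancel h n (q * x)) ⟩
    suc n · h · (q * x)                ≈⟨ ·-swap (suc n) h (q * x) ⟩
    h · suc n · (q * x)                ≈⟨ ×-congʳ h (·-/-cancel h n x) ⟩
    h · h · x                          ≈⟨ ×-assocˡ x h h ⟩
    (h ℕ.* h) · x                      ≤⟨ p ⟩
    (suc n ℕ.* suc n) · y              ≈⟨ ×-assocˡ y (suc n) (suc n) ⟨
    suc n · suc n · y                  ∎))
    where
    q = fromℕ h / fromℕ (suc n)
    q²x≈ : q ^ 2 * x ≈ q * (q * x)
    q²x≈ = ≈-trans (*-congʳ (*-congˡ (*-identityʳ q))) (*-assoc q q x)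

  sum-· : ∀ {n} k (x : Vector Carrier n) → sum (λ i → k · x i) ≈ k · sum x
  sum-· {zero}  k x = ≈-sym (·0≈0 k)
    where
    ·0≈0 : ∀ k → k · 0# ≈ 0#
    ·0≈0 zero    = ≈-refl
    ·0≈0 (suc k) = ≈-trans (+-identityˡ _) (·0≈0 k)
  sum-· {suc n} k x = ≈-trans (+-congˡ (sum-· k (x ∘ suc))) (≈-sym (×-distrib-+ _ _ k))

  -- Sums bounded below by multiples of one element.

  module _ {L : Carrier} where

    ∥∥·⊑sum : ∀ {n} (e : Vector ℕ n) (w : Vector Carrier n) →
      (∀ j → e j · L ⊑ w j) → ∥ e ∥₁ · L ⊑ sum w
    ∥∥·⊑sum {zero}  e w p = ⊑-refl
    ∥∥·⊑sum {suc n} e w p =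
      ≤-respˡ-≈ (≈-sym (×-homo-+ L (e zero) _)) (+-mono-⊑ (p zero) (∥∥·⊑sum (e ∘ suc) (w ∘ suc) (p ∘ suc)))

    -- One index contributes an extra copy of `L`. With norm n + 1 this makes n + 2 copies, which is
    -- the count that the ratio estimate requires.
    suc∥∥·⊑sum : ∀ {n} (e : Vector ℕ n) (w : Vector Carrier n) i →
      (∀ j → e j · L ⊑ w j) → suc (e i) · L ⊑ w i → suc ∥ e ∥₁ · L ⊑ sum w
    suc∥∥·⊑sum e w zero    p q =
      ≤-respˡ-≈ (≈-sym (×-homo-+ L (suc (e zero)) _)) (+-mono-⊑ q (∥∥·⊑sum (e ∘ suc) (w ∘ suc) (p ∘ suc)))
    suc∥∥·⊑sum e w (suc i) p q =
      ≤-respˡ-≈ (≈-trans (≈-sym (×-homo-+ L (e zero) (suc _))) (×-congˡ (ℕ.+-suc (e zero) _)))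
        (+-mono-⊑ (p zero) (suc∥∥·⊑sum (e ∘ suc) (w ∘ suc) i (p ∘ suc) q))

  -- Concave sequences and their partial sums.

  module ConcaveSequence (a : ℕ → Carrier) (N : ℕ) (0⊑a₀ : 0# ⊑ a 0)
    (concave : ∀ k → suc (suc k) ≤ N → a (suc (suc k)) + a k ⊑ 2 · a (suc k)) where

    -- This is the monotonicity of a(k)/k without division. In the inductive step, concavity is
    -- scaled by k + 1 and 2(k + 1) is split as (k + 2) + k; the induction hypothesis bounds the
    -- part with k, after which (k + 1) a(k) cancels. The base case is where a(0) ≥ 0 enters.
    ray : ∀ k → suc k ≤ N → k · a (suc k) ⊑ suc k · a k
    ray zero    _  = ·-nonneg 1 0⊑a₀
    ray (suc k) k+2≤N = +-cancelʳ-⊑ (suc k · a k) (begin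
      suc k · a (suc (suc k)) + suc k · a k    ≈⟨ ×-distrib-+ _ _ (suc k) ⟨
      suc k · (a (suc (suc k)) + a k)          ≤⟨ ·-mono-⊑ (suc k) (concave k k+2≤N) ⟩
      suc k · 2 · a (suc k)                    ≈⟨ ×-assocˡ _ (suc k) 2 ⟩
      (suc k ℕ.* 2) · a (suc k)                ≈⟨ ×-congˡ (regroup k) ⟩
      (suc (suc k) ℕ.+ k) · a (suc k)          ≈⟨ ×-homo-+ _ (suc (suc k)) k ⟩
      suc (suc k) · a (suc k) + k · a (suc k)  ≤⟨ +-mono-⊑ ⊑-refl (ray k (ℕ.<⇒≤ k+2≤N)) ⟩
      suc (suc k) · a (suc k) + suc k · a k    ∎)
      where
      regroup : ∀ k → suc k ℕ.* 2 ≡ suc (suc k) ℕ.+ k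
      regroup = ℕ-Solver.solve-∀

    module _ (G : ℕ → Carrier) (G₀ : G 0 ≈ 0#) (Gₛ : ∀ n → G (suc n) ≈ G n + a (suc n)) where

      -- Induction on the number of terms. Of the n + 3 copies of the new term, two are its own
      -- share of the doubled sum; `ray` trades the other n + 1 for n + 2 copies of the previous
      -- term, which the induction hypothesis covers.
      last-term⊑2·sum : ∀ n → suc n ≤ N → suc (suc n) · a (suc n) ⊑ 2 · G (suc n)
      last-term⊑2·sum zero    _ = ⊑-reflexive (×-congʳ 2 (≈-sym
        (≈-trans (Gₛ 0) (≈-trans (+-congʳ G₀) (+-identityˡ _)))))
      last-term⊑2·sum (suc n) n+2≤N = begin
        suc (suc (suc n)) · x                    ≈⟨ ×-congˡ (ℕ.+-comm 2 (suc n)) ⟩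
        (suc n ℕ.+ 2) · x                        ≈⟨ ×-homo-+ x (suc n) 2 ⟩
        suc n · x + 2 · x                        ≤⟨ +-monoˡ-≤ (2 · x) (ray (suc n) n+2≤N) ⟩
        suc (suc n) · a (suc n) + 2 · x          ≤⟨ +-monoˡ-≤ (2 · x) (last-term⊑2·sum n (ℕ.<⇒≤ n+2≤N)) ⟩
        2 · G (suc n) + 2 · x                    ≈⟨ ×-distrib-+ _ _ 2 ⟨
        2 · (G (suc n) + x)                      ≈⟨ ×-congʳ 2 (Gₛ (suc n)) ⟨
        2 · G (suc (suc n))                      ∎
        where x = a (suc (suc n))

  -- Subtracting 2L from the hypothesis gives nL ≤ 2W′. Hence n²W = n(nW′ + nL) ≤ n(n + 2)W′, and
  -- one more copy of W′ ≥ 0 completes the square (n + 1)².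
  deletion-ratio : ∀ n {W W′ L} → W ≈ W′ + L → 0# ⊑ L → suc (suc n) · L ⊑ 2 · W →
    (n ℕ.* n) · W ⊑ (suc n ℕ.* suc n) · W′
  deletion-ratio n {W} {W′} {L} W≈ 0⊑L p = begin
    (n ℕ.* n) · W                      ≈⟨ ×-assocˡ W n n ⟨
    n · n · W                          ≈⟨ ×-congʳ n (≈-trans (×-congʳ n W≈) (×-distrib-+ W′ L n)) ⟩
    n · (n · W′ + n · L)               ≤⟨ ·-mono-⊑ n (+-mono-⊑ ⊑-refl nL⊑2W′) ⟩
    n · (n · W′ + 2 · W′)              ≈⟨ ×-congʳ n (×-homo-+ W′ n 2) ⟨
    n · (n ℕ.+ 2) · W′                 ≈⟨ ×-assocˡ W′ n (n ℕ.+ 2) ⟩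
    (n ℕ.* (n ℕ.+ 2)) · W′             ≤⟨ x⊑y+x 0⊑W′ ⟩
    suc (n ℕ.* (n ℕ.+ 2)) · W′         ≈⟨ ×-congˡ (square n) ⟩
    (suc n ℕ.* suc n) · W′             ∎
    where
    square : ∀ n → suc (n ℕ.* (n ℕ.+ 2)) ≡ suc n ℕ.* suc n
    square = ℕ-Solver.solve-∀
    nL⊑2W′ : n · L ⊑ 2 · W′
    nL⊑2W′ = +-cancelʳ-⊑ (2 · L) (begin
      n · L + 2 · L        ≈⟨ ×-homo-+ L n 2 ⟨
      (n ℕ.+ 2) · L        ≈⟨ ×-congˡ (ℕ.+-comm n 2) ⟩
      suc (suc n) · L      ≤⟨ p ⟩
      2 · W                ≈⟨ ×-congʳ 2 W≈ ⟩
      2 · (W′ + L)         ≈⟨ ×-distrib-+ W′ L 2 ⟩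
      2 · W′ + 2 · L       ∎)
    0⊑W′ : 0# ⊑ W′
    0⊑W′ = ·-cancelˡ-⊑ 1 (begin
      2 · 0#   ≈⟨ ≈-trans (+-identityˡ _) (+-identityˡ _) ⟩
      0#       ≤⟨ ·-nonneg n 0⊑L ⟩
      n · L    ≤⟨ nL⊑2W′ ⟩
      2 · W′   ∎)

  -- Chains two cross-multiplied ratios by scaling both with the intermediate factor (n + 1)² and
  -- cancelling it.
  telescope : ∀ D n k {W₀ W W′} → (suc n ℕ.* suc n) · W₀ ⊑ D · W →
    (k ℕ.* k) · W ⊑ (suc n ℕ.* suc n) · W′ → (k ℕ.* k) · W₀ ⊑ D · W′
  -- The argument `n ℕ.+ n ℕ.* suc n` is the predecessor of `suc n ℕ.* suc n`, as cancellation
  -- expects a successor.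
  telescope D n k {W₀} {W} {W′} p q = ·-cancelˡ-⊑ (n ℕ.+ n ℕ.* suc n) (begin
    (suc n ℕ.* suc n) · (k ℕ.* k) · W₀   ≈⟨ ·-swap (suc n ℕ.* suc n) (k ℕ.* k) W₀ ⟩
    (k ℕ.* k) · (suc n ℕ.* suc n) · W₀   ≤⟨ ·-mono-⊑ (k ℕ.* k) p ⟩
    (k ℕ.* k) · D · W                    ≈⟨ ·-swap (k ℕ.* k) D W ⟩
    D · (k ℕ.* k) · W                    ≤⟨ ·-mono-⊑ D q ⟩
    D · (suc n ℕ.* suc n) · W′           ≈⟨ ·-swap D (suc n ℕ.* suc n) W′ ⟩
    (suc n ℕ.* suc n) · D · W′           ∎)

  argmin-on : ∀ {m} (x : Fin m → Carrier) (e : Vector ℕ m) → 0 < ∥ e ∥₁ →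
    ∃[ i ] 0 < e i × (∀ j → 0 < e j → x i ⊑ x j)
  argmin-on {m} x e 0<∥e∥ with ∥∥>0⇒∃>0 e 0<∥e∥
  -- The default candidate `i₀` already lies in the support, so the minimizer does too, whether it
  -- is the default or comes from the filtered list.
  ... | i₀ , 0<eᵢ₀ = argmin x i₀ support
    , argmin-all x 0<eᵢ₀ (all-filter positive? (allFin m))
    , λ j 0<eⱼ → All.lookup (f[argmin]≤f[xs] {f = x} i₀ support) (∈-filter⁺ positive? (∈-allFin j) 0<eⱼ)
    where
    open Extrema totalOrder using (argmin; argmin-all; f[argmin]≤f[xs])
    positive? = λ j → 0 ℕ.<? e j
    support = filter positive? (allFin m)

-- Value increase, gains per product and marginal rewards.

module ReverseDeletionProperties {c ℓ₁ ℓ₂} {F : OrderedField c ℓ₁ ℓ₂} (P : Instance F)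
  (s : Vector ℕ (Instance.m P)) where
  open OrderedField F renaming (_≤_ to _⊑_)
  open Instance P
  open OrderedFieldProperties F
  open CommutativeRing commutativeRing
    using (+-commutativeMonoid; +-cong; +-congˡ; +-congʳ; +-comm; +-assoc; +-identityʳ; -‿inverseʳ)
    renaming (sym to ≈-sym; trans to ≈-trans; reflexive to ≈-reflexive)
  open MonoidMult +-commutativeMonoid using (×-congʳ; ×-congˡ; ×-distrib-+)
  open MonoidSum +-commutativeMonoid using (sum-init-last; sum-cong-≋; sum-cong-≗; ∑-distrib-+)
  open import Algebra.Properties.CommutativeSemigroup
    (CommutativeMonoid.commutativeSemigroup +-commutativeMonoid) using (interchange)
  open TotalOrder totalOrder using (poset; ≤-respˡ-≈; ≤-respʳ-≈)
    renaming (refl to ⊑-refl; reflexive to ⊑-reflexive; trans to ⊑-trans)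
  open PartialOrderReasoning poset

  -- The function W of the sketch.
  increase : Vector ℕ m → Carrier
  increase e = V P (s ⊕ e) - V P s

  -- The sequence a(k) of the sketch, with units counted from the base allocation. Index 0 is no
  -- repair unit; it supplies the nonnegative starting value for `ray`.
  marginal : Fin m → ℕ → Carrier
  marginal i n = r i + f i (s i ℕ.+ n)

  gain : Fin m → ℕ → Carrier
  gain i n = R P i (s i ℕ.+ n) - R P i (s i)

  -- `sum` unfolds at the front while the new bonus comes at the end, so the last term is split off
  -- and the `toℕ` of its indices normalized.
  R-suc : ∀ i n → R P i (suc n) ≈ R P i n + (r i + f i (suc n))
  R-suc i n = begin-equality
    (r i + n · r i) + sum terms             ≈⟨ +-cong (+-comm _ _) (sum-init-last terms) ⟩
    (n · r i + r i) + (sum (init terms) + last terms)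
      ≈⟨ +-congˡ (+-cong (≈-reflexive (sum-cong-≗ {n} λ k → ≡.cong (f i ∘ suc) (toℕ-inject₁ k)))
                         (≈-reflexive (≡.cong (f i ∘ suc) (toℕ-fromℕ n)))) ⟩
    (n · r i + r i) + (∑f + f i (suc n))    ≈⟨ interchange (n · r i) (r i) ∑f (f i (suc n)) ⟩
    (n · r i + ∑f) + (r i + f i (suc n))    ∎
    where
    terms : Vector Carrier (suc n)
    terms k = f i (suc (toℕ k))
    ∑f = sum {n} (λ k → f i (suc (toℕ k)))

  R-marginal : ∀ i n → R P i (s i ℕ.+ suc n) ≈ R P i (s i ℕ.+ n) + marginal i (suc n)
  R-marginal i n rewrite ℕ.+-suc (s i) n = R-suc i (s i ℕ.+ n)

  gain-zero : ∀ i → gain i 0 ≈ 0#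
  gain-zero i rewrite ℕ.+-identityʳ (s i) = -‿inverseʳ (R P i (s i))

  gain-suc : ∀ i n → gain i (suc n) ≈ gain i n + marginal i (suc n)
  gain-suc i n = begin-equality
    R P i (s i ℕ.+ suc n) - x    ≈⟨ +-congʳ (R-marginal i n) ⟩
    (y + a) - x                  ≈⟨ +-assoc y a (- x) ⟩
    y + (a - x)                  ≈⟨ +-congˡ (+-comm a (- x)) ⟩
    y + (- x + a)                ≈⟨ +-assoc y (- x) a ⟨
    gain i n + a                 ∎
    where
    x = R P i (s i)
    y = R P i (s i ℕ.+ n)
    a = marginal i (suc n)

  increase≈∑gain : ∀ e → increase e ≈ sum (λ i → gain i (e i))
  increase≈∑gain e = x≈y+z⇒x-y≈z (begin-equality
    V P (s ⊕ e)                                           ≈⟨ sum-cong-≋ (λ i → x-y+y≈x _ (R P i (s i))) ⟨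
    sum (λ i → gain i (e i) + R P i (s i))                ≈⟨ ∑-distrib-+ (λ i → gain i (e i)) _ ⟩
    sum (λ i → gain i (e i)) + V P s                      ≈⟨ +-comm _ _ ⟩
    V P s + sum (λ i → gain i (e i))                      ∎)

  increase-cong : ∀ {e e′} → e ≗ e′ → increase e ≡ increase e′
  increase-cong e≗e′ = ≡.cong (_- V P s)
    (sum-cong-≗ λ i → ≡.cong (λ n → R P i (s i ℕ.+ n)) (e≗e′ i))

  increase-⊖e : ∀ e i → 0 < e i → increase e ≈ increase (e ⊖e i) + marginal i (e i)
  increase-⊖e e i 0<eᵢ = begin-equality
    increase e                                    ≈⟨ increase≈∑gain e ⟩
    sum (λ j → gain j (e j))
      ≈⟨ sum-differ-at +-commutativeMonoid i
           (λ j j≢i → ≈-reflexive (≡.cong (gain j) (⊖e-off e i j j≢i))) at-i ⟩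
    sum (λ j → gain j ((e ⊖e i) j)) + marginal i (e i)
      ≈⟨ +-congʳ (increase≈∑gain (e ⊖e i)) ⟨
    increase (e ⊖e i) + marginal i (e i)          ∎
    where
    at-i : gain i (e i) ≈ gain i ((e ⊖e i) i) + marginal i (e i)
    at-i rewrite ⊖e-at e i 0<eᵢ = gain-suc i _

  -- Makes the greedy rule, which compares values of whole allocations, a comparison of single
  -- marginal rewards.
  deletionLoss≈marginal : ∀ e i → 0 < e i → deletionLoss P s e i ≈ marginal i (e i)
  deletionLoss≈marginal e i 0<eᵢ = x≈y+z⇒x-y≈z (begin-equality
    V P (s ⊕ e)                                  ≈⟨ x-y+y≈x _ (V P s) ⟨
    increase e + V P s                           ≈⟨ +-congʳ (increase-⊖e e i 0<eᵢ) ⟩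
    increase (e ⊖e i) + L + V P s                ≈⟨ +-assoc _ L _ ⟩
    increase (e ⊖e i) + (L + V P s)              ≈⟨ +-congˡ (+-comm L _) ⟩
    increase (e ⊖e i) + (V P s + L)              ≈⟨ +-assoc _ _ L ⟨
    increase (e ⊖e i) + V P s + L                ≈⟨ +-congʳ (x-y+y≈x _ (V P s)) ⟩
    V P (s ⊕ (e ⊖e i)) + L                       ∎)
    where L = marginal i (e i)

  marginal-nonneg : ∀ i n → 0# ⊑ marginal i n
  marginal-nonneg i n = nonneg-+ (r-nonneg i) (f-nonneg i _)

  -- The estimate for a single deletion.

  module _ (admissible : AdmissibleBonuses P) (feasible : IsFeasible P s) where
    open AdmissibleBonuses admissible

    f-second-difference : ∀ i k → suc k < b i → f i (suc (suc k)) + f i k ⊑ 2 · f i (suc k)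
    f-second-difference i k k+1<b = begin
      f i (suc (suc k)) + x            ≈⟨ +-congʳ (x-y+y≈x _ y) ⟨
      f i (suc (suc k)) - y + y + x    ≤⟨ +-monoˡ-≤ x (+-monoˡ-≤ y (f-concave i k k+1<b)) ⟩
      y - x + y + x                    ≈⟨ +-assoc _ y x ⟩
      y - x + (y + x)                  ≈⟨ +-congˡ (+-comm y x) ⟩
      y - x + (x + y)                  ≈⟨ +-assoc _ x y ⟨
      y - x + x + y                    ≈⟨ +-cong (x-y+y≈x y x) (≈-sym (+-identityʳ y)) ⟩
      2 · y                            ∎
      where
      x = f i k
      y = f i (suc k)

    marginal-concave : ∀ i k → suc (suc k) ≤ b i ∸ s i →
      marginal i (suc (suc k)) + marginal i k ⊑ 2 · marginal i (suc k)
    marginal-concave i k k+2≤ = begin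
      (r i + f i (s i ℕ.+ suc (suc k))) + (r i + f i (s i ℕ.+ k))
        ≈⟨ interchange (r i) _ (r i) _ ⟩
      (r i + r i) + (f i (s i ℕ.+ suc (suc k)) + f i (s i ℕ.+ k))
        ≤⟨ +-mono-⊑ (⊑-reflexive (+-congˡ (≈-sym (+-identityʳ (r i))))) shifted ⟩
      2 · r i + 2 · f i (s i ℕ.+ suc k)
        ≈⟨ ×-distrib-+ (r i) _ 2 ⟨
      2 · marginal i (suc k)    ∎
      where
      -- The subtraction in the capacity bound is truncated; feasibility of `s` is what allows `s i`
      -- to be moved to the other side.
      in-range : suc (suc (s i ℕ.+ k)) ≤ b i
      in-range = ≡.subst (_≤ b i) (≡.cong (2 ℕ.+_) (ℕ.+-comm k (s i)))
        (ℕ.m≤o∸n⇒m+n≤o (suc (suc k)) (feasible i) k+2≤)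
      shifted : f i (s i ℕ.+ suc (suc k)) + f i (s i ℕ.+ k) ⊑ 2 · f i (s i ℕ.+ suc k)
      shifted rewrite ℕ.+-suc (s i) (suc k) | ℕ.+-suc (s i) k = f-second-difference i (s i ℕ.+ k) in-range

    -- The concave-sequence estimate, with `gain i` as the partial sums. Positivity of `n` matters:
    -- at 0 the gain vanishes while the marginal reward may be positive.
    suc·marginal⊑2·gain : ∀ i n → 0 < n → n ≤ b i ∸ s i → suc n · marginal i n ⊑ 2 · gain i n
    suc·marginal⊑2·gain i (suc n) _ n+1≤ =
      ConcaveSequence.last-term⊑2·sum (marginal i) (b i ∸ s i) (marginal-nonneg i 0) (marginal-concave i)
        (gain i) (gain-zero i) (gain-suc i) n n+1≤

    module _ (e : Vector ℕ m) (inc : IsRepairIncrement P s e) (i : Fin m) (0<eᵢ : 0 < e i)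
      (least : ∀ j → 0 < e j → deletionLoss P s e i ⊑ deletionLoss P s e j) where

      least-marginal : ∀ j → 0 < e j → marginal i (e i) ⊑ marginal j (e j)
      least-marginal j 0<eⱼ = ≤-respˡ-≈ (deletionLoss≈marginal e i 0<eᵢ)
        (≤-respʳ-≈ (deletionLoss≈marginal e j 0<eⱼ) (least j 0<eⱼ))

      suc·least⊑2·gain : ∀ j → 0 < e j → suc (e j) · marginal i (e i) ⊑ 2 · gain j (e j)
      suc·least⊑2·gain j 0<eⱼ = ⊑-trans (·-mono-⊑ (suc (e j)) (least-marginal j 0<eⱼ))
        (suc·marginal⊑2·gain j (e j) 0<eⱼ (inc j))

      -- A weaker bound that also covers products absent from `e`, where both sides vanish. For the
      -- others one nonnegative copy of the least marginal is given up.
      ·least⊑2·gain : ∀ j → e j · marginal i (e i) ⊑ 2 · gain j (e j)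
      ·least⊑2·gain j with e j in eq
      ... | zero  = ⊑-reflexive (≈-sym (≈-trans (×-congʳ 2 (gain-zero j))
        (≈-trans (+-congˡ (+-identityʳ 0#)) (+-identityʳ 0#))))
      ... | suc n = ⊑-trans (x⊑y+x (marginal-nonneg i (e i)))
        (≡.subst (λ n → suc n · marginal i (e i) ⊑ 2 · gain j n) eq
          (suc·least⊑2·gain j (≡.subst (0 <_) (≡.sym eq) (s≤s z≤n))))

      deletion-bound : let n = ∥ e ⊖e i ∥₁ in
        (n ℕ.* n) · increase e ⊑ (suc n ℕ.* suc n) · increase (e ⊖e i)
      deletion-bound = deletion-ratio ∥ e ⊖e i ∥₁ (increase-⊖e e i 0<eᵢ) (marginal-nonneg i (e i)) (begin
        suc (suc ∥ e ⊖e i ∥₁) · L            ≈⟨ ×-congˡ (≡.cong suc (∥⊖e∥ e i 0<eᵢ)) ⟨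
        suc ∥ e ∥₁ · L
          -- Only the deleted product, which is certainly present in `e`, keeps its extra copy of
          -- `L`.
          ≤⟨ suc∥∥·⊑sum e (λ j → 2 · gain j (e j)) i ·least⊑2·gain (suc·least⊑2·gain i 0<eᵢ) ⟩
        sum (λ j → 2 · gain j (e j))         ≈⟨ sum-· 2 (λ j → gain j (e j)) ⟩
        2 · sum (λ j → gain j (e j))         ≈⟨ ×-congʳ 2 (increase≈∑gain e) ⟨
        2 · increase e                       ∎)
        where L = marginal i (e i)

  -- Runs of reverse deletion and their invariants.

  module _ {ℓ} (Q : Vector ℕ m → Set ℓ) (Q-resp : ∀ {e e′} → e ≗ e′ → Q e → Q e′)
    (Q-delete : ∀ e i → 0 < e i → (∀ j → 0 < e j → deletionLoss P s e i ⊑ deletionLoss P s e j) →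
      Q e → Q (e ⊖e i)) where

    -- The prefixes of the reversed deletion list are exactly the increments visited by the run, so
    -- a property preserved by greedy deletions holds for all of them. Induction on the run, for an
    -- arbitrary list `δ₀` of earlier deletions: the first product deleted goes to the end of the
    -- order for the rest. Visited increments and prefixes agree only pointwise, hence `Q-resp`.
    run-invariant : ∀ {e δ₀ rem δ} → Star (DeletionStep P s) (e , δ₀) (rem , δ) → ∥ rem ∥₁ ≡ 0 →
      Q e →
      ∃[ η ] δ ≡ δ₀ ++ reverse η × (∀ i → occurrences i η ≡ e i) × (∀ h → Q (prefixIncrement η h))
    run-invariant {e} {δ₀} ε ∥e∥≡0 q =
      [] , ≡.sym (++-identityʳ δ₀) , (λ i → ≡.sym (e≗0 i)) , λ h → Q-resp (λ i → ≡.trans (e≗0 i) (prefix-[] i h)) q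
      where
      e≗0 = ∥∥≡0⇒≡0 e ∥e∥≡0
      prefix-[] : ∀ i h → 0 ≡ prefixIncrement [] h i
      prefix-[] i zero    = refl
      prefix-[] i (suc h) = refl
    run-invariant {e} {δ₀} (delete i 0<eᵢ least ◅ steps) ∥rem∥≡0 q
      with run-invariant steps ∥rem∥≡0 (Q-delete e i 0<eᵢ least q)
    ... | η , δ≡ , occ≡ , Q-prefix = η ∷ʳ i , δ≡′ , occ≡′ , Q-prefix′
      where
      δ≡′ : _ ≡ δ₀ ++ reverse (η ∷ʳ i)
      δ≡′ = ≡.trans δ≡ (≡.trans (++-assoc δ₀ (i ∷ []) (reverse η))
        (≡.cong (δ₀ ++_) (≡.sym (reverse-++ η (i ∷ [])))))
      occ≡′ : ∀ j → occurrences j (η ∷ʳ i) ≡ e j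
      occ≡′ j with j ≟ i
      ... | yes refl = ≡.trans (occurrences-∷ʳ-same i η) (≡.trans (≡.cong suc (occ≡ i)) (≡.sym (⊖e-at e i 0<eᵢ)))
      ... | no j≢i   = ≡.trans (occurrences-∷ʳ-other η j≢i) (≡.trans (occ≡ j) (≡.sym (⊖e-off e i j j≢i)))
      Q-prefix′ : ∀ h → Q (prefixIncrement (η ∷ʳ i) h)
      Q-prefix′ h with h ℕ.≤? length η
      ... | yes h≤ = Q-resp (λ j → ≡.cong (occurrences j) (≡.sym (take-++ˡ h η (i ∷ []) h≤))) (Q-prefix h)
      -- A longer prefix is all of `η ∷ʳ i`, whose counts are those of the current increment `e`.
      ... | no h≰  = Q-resp (λ j → ≡.sym (≡.trans (≡.cong (occurrences j) (take-all h (η ∷ʳ i) all)) (occ≡′ j))) q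
        where
        all : length (η ∷ʳ i) ≤ h
        all = ≡.subst (_≤ h) (≡.trans (ℕ.+-comm 1 _) (≡.sym (length-++ η))) (ℕ.≰⇒> h≰)

  -- The norm drops by one at each deletion, so it serves as the recursion measure; while it is
  -- positive a minimizer exists.
  run-exists : ∀ n (e : Vector ℕ m) δ₀ → ∥ e ∥₁ ≡ n →
    ∃[ δ ] ∃[ rem ] Star (DeletionStep P s) (e , δ₀) (rem , δ) × ∥ rem ∥₁ ≡ 0
  run-exists zero    e δ₀ ∥e∥≡0 = δ₀ , e , ε , ∥e∥≡0
  run-exists (suc n) e δ₀ ∥e∥≡
    with argmin-on (deletionLoss P s e) e (≡.subst (0 <_) (≡.sym ∥e∥≡) (s≤s z≤n))
  ... | i , 0<eᵢ , least
    with run-exists n (e ⊖e i) (δ₀ ∷ʳ i) (ℕ.suc-injective (≡.trans (≡.sym (∥⊖e∥ e i 0<eᵢ)) ∥e∥≡))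
  ...   | δ , rem , steps , ∥rem∥≡0 = δ , rem , delete i 0<eᵢ least ◅ steps , ∥rem∥≡0

  -- The quadratic bound along a run.

  module _ (admissible : AdmissibleBonuses P) (feasible : IsFeasible P s) (d : Vector ℕ m)
    (inc : IsRepairIncrement P s d) (1≤∥d∥ : 1 ≤ ∥ d ∥₁) where

    -- The desired inequality, cross-multiplied and with h replaced by the norm of the increment.
    -- The capacity condition travels along because the single-deletion estimate needs it at every
    -- increment visited.
    Bounded : Vector ℕ m → Set ℓ₂
    Bounded e = IsRepairIncrement P s e
      × (∥ e ∥₁ ℕ.* ∥ e ∥₁) · increase d ⊑ (∥ d ∥₁ ℕ.* ∥ d ∥₁) · increase e

    Bounded-resp : ∀ {e e′} → e ≗ e′ → Bounded e → Bounded e′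
    Bounded-resp e≗e′ (inc-e , bound) =
        (λ i → ≡.subst (_≤ b i ∸ s i) (e≗e′ i) (inc-e i))
      , ≡.subst₂ (λ n W → (n ℕ.* n) · increase d ⊑ (∥ d ∥₁ ℕ.* ∥ d ∥₁) · W) (∥∥-cong e≗e′) (increase-cong e≗e′) bound

    Bounded-delete : ∀ e i → 0 < e i → (∀ j → 0 < e j → deletionLoss P s e i ⊑ deletionLoss P s e j) →
      Bounded e → Bounded (e ⊖e i)
    Bounded-delete e i 0<eᵢ least (inc-e , bound) =
        (λ j → ℕ.≤-trans (⊖e≤ e i j) (inc-e j))
      , telescope (∥ d ∥₁ ℕ.* ∥ d ∥₁) ∥ e ⊖e i ∥₁ ∥ e ⊖e i ∥₁
          (≡.subst (λ n → (n ℕ.* n) · increase d ⊑ (∥ d ∥₁ ℕ.* ∥ d ∥₁) · increase e) (∥⊖e∥ e i 0<eᵢ) bound)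
          (deletion-bound admissible feasible e inc-e i 0<eᵢ least)

    reverse-deletion-bound : ∀ {δ} → ReverseDeletion P s d δ →
      IsRepairOrder d (reverse δ) × QuadraticBound P s d (reverse δ)
    reverse-deletion-bound (_ , steps , ∥rem∥≡0)
      -- At `d` itself the two sides of the invariant coincide.
      with run-invariant Bounded Bounded-resp Bounded-delete steps ∥rem∥≡0 (inc , ⊑-refl)
    ... | η , refl , occ≡ , bounded rewrite reverse-involutive η = order , quadratic
      where
      order : IsRepairOrder d η
      order = occurrences≡⇒IsRepairOrder occ≡
      quadratic : QuadraticBound P s d η
      quadratic h h≤ = square-ratio-bound h ∥ d ∥₁ 1≤∥d∥
        -- The invariant speaks of the norm of the prefix increment, which equals `h` as `h` does
        -- not exceed the length of the order.
        (≡.subst (λ k → (k ℕ.* k) · increase d ⊑ (∥ d ∥₁ ℕ.* ∥ d ∥₁) · increase (prefixIncrement η h))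
          (∥prefixIncrement∥ η (≡.subst (h ≤_) (≡.sym (IsRepairOrder.length≡ order)) h≤)) (proj₂ (bounded h)))

lemma1 : ∀ {c ℓ₁ ℓ₂} (F : OrderedField c ℓ₁ ℓ₂) (P : Instance F) →
    AdmissibleBonuses P →
    (s : Vector ℕ (Instance.m P)) → IsFeasible P s →
    (d : Vector ℕ (Instance.m P)) → IsRepairIncrement P s d →
    1 ≤ ∥ d ∥₁ →
    (∃[ η ] IsRepairOrder d η × QuadraticBound P s d η)
    × (∃[ δ ] ReverseDeletion P s d δ)
    × ((δ : List (Fin (Instance.m P))) → ReverseDeletion P s d δ →
        IsRepairOrder d (reverse δ) × QuadraticBound P s d (reverse δ))
lemma1 F P admissible s feasible d inc 1≤∥d∥ =
  (reverse δ , reverse-deletion-bound admissible feasible d inc 1≤∥d∥ run) , (δ , run)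
    , λ _ → reverse-deletion-bound admissible feasible d inc 1≤∥d∥
  where
  open ReverseDeletionProperties P s
  δ   = proj₁ (run-exists ∥ d ∥₁ d [] refl)
  run = proj₂ (run-exists ∥ d ∥₁ d [] refl)
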